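{- Consider inputs consisting of a connected graph $G=(V,E)$, a graph $G'=(V,E')$ with $E\subseteq E'$, and a partial function $\tilde x\in\{0,1,*\}^{E'}$. Consistency of $\tilde x$, i.e., whether $X_{GG'}[\tilde x]\ne\emptyset$, can be decided in polynomial time if $E\subseteq\operatorname{dom}\tilde x$ or $$\forall vw\in\operatorname{dom}\tilde x\setminus E:\quad \tilde x_{vw}=1\ \vee\ \exists P\in vw\text{ -paths}(G)\ \forall e\in P:\ \tilde x_e=0 .$$
   Context: All graphs are finite, simple and undirected; an edge $\{v,w\}$ is also written $vw$. Paths and cycles have no repeated nodes and are identified with their edge sets. For a graph $G=(V,E)$ and distinct $v,w\in V$, $vw\text{ -paths}(G)$ is the set of all paths in $G$ from $v$ to $w$; a $vw$-cut of $G$ is an inclusion-minimal set $C\subseteq E$ such that $v$ and $w$ are not connected in $(V,E\setminus C)$, and $vw\text{ -cuts}(G)$ is the set of all of these. For a connected graph $G=(V,E)$ and a graph $G'=(V,E')$ with $E\subseteq E'$, let $F_{GG'}:=E'\setminus E$ and let $X_{GG'}$ be the set of all $x\in\{0,1\}^{E'}$ such that (i) $x_e\le\sum_{e'\in C\setminus\{e\}}x_{e'}$ for every cycle $C$ of $G$ and every $e\in C$; (ii) $x_{vw}\le\sum_{e\in P}x_e$ for every $vw\in F_{GG'}$ and every $P\in vw\text{ -paths}(G)$; (iii) $1-x_{vw}\le\sum_{e\in C}(1-x_e)$ for every $vw\in F_{GG'}$ and every $C\in vw\text{ -cuts}(G)$. $\{0,1,*\}^{E'}:=\bigcup_{F\subseteq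 E'}\{0,1\}^F$ is the set of partial functions from $E'$ to $\{0,1\}$; $\operatorname{dom}\tilde x$ denotes the domain of $\tilde x$; $\tilde x_e=0$ means $e\in\operatorname{dom}\tilde x$ and $\tilde x$ takes the value $0$ at $e$. Let $X_{GG'}[\tilde x]:=\{x\in X_{GG'}\mid \forall e\in\operatorname{dom}\tilde x:\ x_e=\tilde x_e\}$. -}

module Defs where

open import Data.Bool using (Bool; true; false; T)
open import Data.Bool.Properties using (T?)
open import Data.Fin using (Fin; zero; suc; toℕ; _<_)
open import Data.Fin.Patterns using (0F; 1F)
open import Data.Fin.Properties using (<-cmp)
open import Data.List using (List; []; _∷_; length; map; sum; tabulate)
open import Data.List.Membership.Propositional using (_∈_; _∉_)
open import Data.List.Relation.Binary.Subset.Propositional using (_⊆_)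
open import Data.List.Relation.Unary.All using (All)
open import Data.List.Relation.Unary.Any using (_─_)
open import Data.List.Relation.Unary.Unique.Propositional using (Unique)
open import Data.Maybe using (Maybe; just; nothing; Is-just; _>>=_)
open import Data.Nat using (ℕ; zero; suc; _+_; _*_; _^_; _∸_; _≤_)
open import Data.Product using (Σ; Σ-syntax; ∃; ∃-syntax; _×_; _,_)
open import Data.Sum using (_⊎_)
open import Data.Vec using (Vec; _∷_; lookup; replicate; _[_]≔_)
open import Relation.Binary.Definitions using (tri<; tri≈; tri>)
open import Relation.Binary.PropositionalEquality using (_≡_; _≢_)
open import Relation.Nullary using (¬_; yes; no)
open import Relation.Nullary.Reflects using (Reflects)

------------------------------------------------------------------------
-- Graphs

record Graph (n : ℕ) : Set where
  field
    adj         : Fin n → Fin n → Bool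
    symmetric   : ∀ u v → adj u v ≡ adj v u
    irreflexive : ∀ v → adj v v ≡ false

open Graph public

-- The edge {v , w} is stored once, with its smaller endpoint first. The last
-- two fields are irrelevant, so edges with equal endpoints are equal.
record Edge {n : ℕ} (G : Graph n) : Set where
  constructor edge
  field
    lo hi    : Fin n
    .ordered : lo < hi
    .present : T (adj G lo hi)

open Edge public using (lo; hi)

infix 4 _⊆ᴳ_

_⊆ᴳ_ : ∀ {n} → Graph n → Graph n → Set
G ⊆ᴳ G′ = ∀ u v → T (adj G u v) → T (adj G′ u v)

include : ∀ {n} {G G′ : Graph n} → G ⊆ᴳ G′ → Edge G → Edge G′
include G⊆G′ (edge u v u<v uv∈G) = edge u v u<v (G⊆G′ u v uv∈G)

edgeBetween : ∀ {n} (G : Graph n) → Fin n → Fin n → Maybe (Edge G)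
edgeBetween G u v with <-cmp u v | T? (adj G u v) | T? (adj G v u)
... | tri< u<v _ _ | yes uv∈G | _        = just (edge u v u<v uv∈G)
... | tri> _ _ v<u | _        | yes vu∈G = just (edge v u v<u vu∈G)
... | _            | _        | _        = nothing

data Joins {n} {G : Graph n} (e : Edge G) : Fin n → Fin n → Set where
  forward  : Joins e (lo e) (hi e)
  backward : Joins e (hi e) (lo e)

data Walk {n} (G : Graph n) : Fin n → Fin n → Set where
  []   : ∀ {v} → Walk G v v
  step : ∀ {u v w} (e : Edge G) → Joins e u v → Walk G v w → Walk G u w

walkNodes : ∀ {n} {G : Graph n} {v w} → Walk G v w → List (Fin n)
walkNodes {v = v} []           = v ∷ []
walkNodes {v = v} (step _ _ p) = v ∷ walkNodes p

walkEdges : ∀ {n} {G : Graph n} {v w} → Walk G v w → List (Edge G)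
walkEdges []           = []
walkEdges (step e _ p) = e ∷ walkEdges p

Connected : ∀ {n} → Graph n → Set
Connected G = ∀ v w → Walk G v w

record Path {n} (G : Graph n) (v w : Fin n) : Set where
  field
    walk   : Walk G v w
    simple : Unique (walkNodes walk)

pathEdges : ∀ {n} {G : Graph n} {v w} → Path G v w → List (Edge G)
pathEdges P = walkEdges (Path.walk P)

-- A path with at least two edges, closed up by an edge between its ends.
record Cycle {n} (G : Graph n) : Set where
  field
    {start end} : Fin n
    path        : Path G start end
    long        : 2 ≤ length (pathEdges path)
    closing     : Edge G
    closes      : Joins closing end start

cycleEdges : ∀ {n} {G : Graph n} → Cycle G → List (Edge G)
cycleEdges C = Cycle.closing C ∷ pathEdges (Cycle.path C)

-- Sets of edges are represented by lists. The edge lists of paths and cycles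
-- never contain duplicates; for cuts this is required explicitly.
Separates : ∀ {n} (G : Graph n) (v w : Fin n) → List (Edge G) → Set
Separates G v w C = ¬ (Σ[ p ∈ Walk G v w ] All (_∉ C) (walkEdges p))

record Cut {n} (G : Graph n) (v w : Fin n) : Set where
  field
    cutEdges  : List (Edge G)
    unique    : Unique cutEdges
    separates : Separates G v w cutEdges
    minimal   : ∀ D → D ⊆ cutEdges → Separates G v w D → cutEdges ⊆ D

open Cut public using (cutEdges)

------------------------------------------------------------------------
-- The set X_{GG′} and partial labelings

-- f ∈ F_{GG′} = E′ ∖ E
Lifted : ∀ {n} (G : Graph n) {G′ : Graph n} → Edge G′ → Set
Lifted G f = ¬ T (adj G (lo f) (hi f))

record X {n} (G G′ : Graph n) (G⊆G′ : G ⊆ᴳ G′) (x : Edge G′ → Fin 2) : Set where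
  value : Edge G → ℕ
  value e = toℕ (x (include G⊆G′ e))

  field
    cycles : ∀ (C : Cycle G) {e} (e∈C : e ∈ cycleEdges C) →
             value e ≤ sum (map value (cycleEdges C ─ e∈C))
    paths  : ∀ f → Lifted G f → (P : Path G (lo f) (hi f)) →
             toℕ (x f) ≤ sum (map value (pathEdges P))
    cuts   : ∀ f → Lifted G f → (C : Cut G (lo f) (hi f)) →
             1 ∸ toℕ (x f) ≤ sum (map (λ e → 1 ∸ value e) (cutEdges C))

record Instance : Set where
  field
    n         : ℕ
    G G′      : Graph n
    connected : Connected G
    G⊆G′      : G ⊆ᴳ G′
    x̃         : Edge G′ → Maybe (Fin 2)

module _ (I : Instance) where
  open Instance I

  dom : Edge G′ → Set
  dom e = Is-just (x̃ e)

  Consistent : Set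
  Consistent = ∃[ x ] X G G′ G⊆G′ x × (∀ e b → x̃ e ≡ just b → x e ≡ b)

  E⊆dom : Set
  E⊆dom = ∀ (e : Edge G) → dom (include G⊆G′ e)

  LiftedZerosHaveZeroPaths : Set
  LiftedZerosHaveZeroPaths =
    ∀ f → dom f → Lifted G f →
      x̃ f ≡ just 1F ⊎
      (Σ[ P ∈ Path G (lo f) (hi f) ]
        All (λ e → x̃ (include G⊆G′ e) ≡ just 0F) (pathEdges P))

------------------------------------------------------------------------
-- Polynomial time
--
-- The machine model is N. D. Jones' language WHILE over binary trees, with
-- his time measure ("Computability and Complexity", MIT Press, 1997), where
-- it is shown that the problems decidable in polynomial time by WHILE
-- programs are exactly those decidable in polynomial time by Turing machines.
-- The only atom is nil, and a conditional is included.

infixr 5 _∙_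

data Tree : Set where
  nil : Tree
  _∙_ : Tree → Tree → Tree

size : Tree → ℕ
size nil     = 1
size (s ∙ t) = suc (size s + size t)

head tail : Tree → Tree
head nil     = nil
head (s ∙ t) = s
tail nil     = nil
tail (s ∙ t) = t

data Exp (k : ℕ) : Set where
  var   : Fin k → Exp k
  nil   : Exp k
  cons  : Exp k → Exp k → Exp k
  hd tl : Exp k → Exp k

infix  6 _≔_
infixr 5 _⨾_

data Cmd (k : ℕ) : Set where
  _≔_           : Fin k → Exp k → Cmd k
  _⨾_           : Cmd k → Cmd k → Cmd k
  if_then_else_ : Exp k → Cmd k → Cmd k → Cmd k
  while         : Exp k → Cmd k → Cmd k

Store : ℕ → Set
Store = Vec Tree

eval : ∀ {k} → Exp k → Store k → Tree
eval (var i)    σ = lookup σ i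
eval nil        σ = nil
eval (cons a b) σ = eval a σ ∙ eval b σ
eval (hd a)     σ = head (eval a σ)
eval (tl a)     σ = tail (eval a σ)

cost : ∀ {k} → Exp k → ℕ
cost (var i)    = 1
cost nil        = 1
cost (cons a b) = 1 + cost a + cost b
cost (hd a)     = 1 + cost a
cost (tl a)     = 1 + cost a

infix 4 ⟨_,_⟩⇓_[_]

-- ⟨ c , σ ⟩⇓ σ′ [ t ] : started in σ, c terminates in σ′ after time t.
-- A test succeeds iff its value is not nil.
data ⟨_,_⟩⇓_[_] {k} : Cmd k → Store k → Store k → ℕ → Set where
  assign  : ∀ {i a σ} →
            ⟨ i ≔ a , σ ⟩⇓ σ [ i ]≔ eval a σ [ 1 + cost a ]
  seq     : ∀ {c d σ σ′ σ″ s t} →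
            ⟨ c , σ ⟩⇓ σ′ [ s ] → ⟨ d , σ′ ⟩⇓ σ″ [ t ] →
            ⟨ c ⨾ d , σ ⟩⇓ σ″ [ s + t ]
  ifTrue  : ∀ {a c d σ σ′ t} → eval a σ ≢ nil →
            ⟨ c , σ ⟩⇓ σ′ [ t ] →
            ⟨ if a then c else d , σ ⟩⇓ σ′ [ 1 + cost a + t ]
  ifFalse : ∀ {a c d σ σ′ t} → eval a σ ≡ nil →
            ⟨ d , σ ⟩⇓ σ′ [ t ] →
            ⟨ if a then c else d , σ ⟩⇓ σ′ [ 1 + cost a + t ]
  loop    : ∀ {a c σ σ′ σ″ s t} → eval a σ ≢ nil →
            ⟨ c , σ ⟩⇓ σ′ [ s ] → ⟨ while a c , σ′ ⟩⇓ σ″ [ t ] →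
            ⟨ while a c , σ ⟩⇓ σ″ [ 1 + cost a + s + t ]
  exit    : ∀ {a c σ} → eval a σ ≡ nil →
            ⟨ while a c , σ ⟩⇓ σ [ 1 + cost a ]

-- Variable 0 holds the input at the start and the output at the end; all
-- other variables are initially nil.
record Program : Set where
  field
    {extra} : ℕ
    body    : Cmd (suc extra)

Runs : Program → Tree → Tree → ℕ → Set
Runs p input output t =
  ∃[ σ ] ⟨ body , input ∷ replicate extra nil ⟩⇓ σ [ t ] × lookup σ zero ≡ output
  where open Program p

encodeBool : Bool → Tree
encodeBool false = nil
encodeBool true  = nil ∙ nil

encodeLabel : Maybe (Fin 2) → Tree
encodeLabel nothing   = nil
encodeLabel (just 0F) = nil ∙ nil
encodeLabel (just 1F) = (nil ∙ nil) ∙ nil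

encodeList : List Tree → Tree
encodeList []       = nil
encodeList (t ∷ ts) = t ∙ encodeList ts

-- A single program with a single bound c · sᵏ, s being the size of the encoded
-- input, answers correctly on every input satisfying the promise. As s ≥ 1,
-- such bounds dominate all polynomials.
DecidableInPolynomialTime :
  {Input : Set} → (Input → Tree) → (promise problem : Input → Set) → Set
DecidableInPolynomialTime {Input} encode promise problem =
  Σ[ p ∈ Program ] Σ[ c ∈ ℕ ] Σ[ k ∈ ℕ ]
    ((i : Input) → promise i →
      Σ[ b ∈ Bool ] Σ[ t ∈ ℕ ]
        Runs p (encode i) (encodeBool b) t ×
        t ≤ c * size (encode i) ^ k ×
        Reflects (problem i) b)

-- An n × n matrix, given as the list of its rows. The entry at (u , v) tells
-- whether uv ∈ E and whether uv ∈ E′, and gives the value of x̃ at uv, if any.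
encode : Instance → Tree
encode I = encodeList (tabulate λ u → encodeList (tabulate λ v → entry u v))
  where
  open Instance I
  entry : Fin n → Fin n → Tree
  entry u v = encodeBool (adj G u v) ∙ encodeBool (adj G′ u v) ∙
              encodeLabel (edgeBetween G′ u v >>= x̃)

{-# OPTIONS --safe #-}

-- Under either promise, x̃ is consistent iff, for every edge f in its domain,
-- x̃ f = 0 exactly when the ends of f are connected by edges of G labeled 0: in
-- that case the labeling that is 0 exactly on the edges with so connected ends
-- extends x̃ and lies in X. Conversely, a path of 0-edges forbids the label 1 by
-- the cycle and path inequalities. For x̃ f = 0 with f ∉ E, the second promise
-- gives a path, while under the first one all edges of G that are not labeled 0
-- are labeled 1, so that if there were no path they would contain a cut.
-- Connectedness is computed by squaring the adjacency matrix of the 0-edges n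
-- times: each squaring covers walks with at least one more edge, and a simple
-- path has fewer than n edges.

module Submission where

open import Data.Bool using (Bool; true; false; T; _∧_; _∨_; not)
open import Data.Bool.Properties using (T?; T-∧; T-∨; ∨-assoc)
open import Data.Empty using (⊥)
open import Data.Fin using (Fin; zero; suc; toℕ)
open import Data.Fin.Patterns using (0F; 1F)
open import Data.Fin.Properties using (_≟_; <-cmp; <-irrefl; injective⇒≤; toℕ<n)
open import Data.List using (List; []; _∷_; length; lookup; map; mapMaybe; filter; deduplicate; tabulate; allFin; cartesianProduct)
open import Data.List.Membership.DecPropositional using (_∈?_)
open import Data.List.Membership.Propositional using (_∈_; _∉_; find; lose)
open import Data.List.Membership.Propositional.Properties using (∈-lookup; ∈-filter⁺; ∈-filter⁻; ∈-deduplicate⁺; ∈-allFin; ∈-cartesianProduct⁺)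
open import Data.List.Properties using (filter-notAll)
open import Data.List.Relation.Binary.Subset.Propositional using (_⊆_)
open import Data.List.Relation.Unary.All as All using (All; []; _∷_)
open import Data.List.Relation.Unary.All.Properties using (¬Any⇒All¬)
open import Data.List.Relation.Unary.AllPairs using ([]; _∷_)
open import Data.List.Relation.Unary.Any as Any using (here; there; _─_)
import Data.List.Relation.Unary.Any.Properties as Any
open import Data.List.Relation.Unary.Unique.DecPropositional.Properties using (deduplicate-!)
open import Data.List.Relation.Unary.Unique.Propositional using (Unique)
open import Data.List.Relation.Unary.Unique.Propositional.Properties using (filter⁺)
open import Data.Maybe using (Maybe; just; nothing; maybe′; Is-just; _>>=_)
open import Data.Maybe.Properties using (just-injective; ≡-dec)
import Data.Maybe.Relation.Unary.Any as Maybe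
open import Data.Nat as ℕ using (ℕ; zero; suc; _+_; _*_; _^_; _∸_; _≤_; z≤n; s≤s; s≤s⁻¹)
open import Data.Nat.GeneralisedArithmetic using (iterate)
open import Data.Nat.ListAction using (sum)
import Data.Nat.Properties as ℕ
open import Data.Product using (Σ-syntax; ∃-syntax; _×_; _,_; proj₁; proj₂)
open import Data.Sum using (_⊎_; inj₁; inj₂; [_,_]′)
open import Data.Vec using (_∷_; [])
open import Function using (_∘_; Equivalence)
open import Relation.Binary.Definitions using (DecidableEquality; tri<; tri≈; tri>)
open import Relation.Binary.PropositionalEquality
open import Relation.Nullary using (¬_; Dec; yes; no; contradiction; ¬?)
open import Relation.Nullary.Decidable using (map′; ⌊_⌋; toWitness; fromWitness; recompute; decidable-stable)
open import Relation.Nullary.Negation using (contradiction-irr)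
open import Relation.Nullary.Reflects using (Reflects; ofʸ; ofⁿ)
open import Relation.Unary using (Decidable)
open import Defs

-- Polynomial time bounds

-- The base `suc n` is positive, so powers grow with the exponent, and by `list-size` it is at most
-- the size of an encoded matrix with `n` rows.
Polynomial : (ℕ → ℕ) → Set
Polynomial t = ∃[ c ] ∃[ k ] ∀ n → t n ≤ c * suc n ^ k

const-polynomial : ∀ m → Polynomial (λ _ → m)
const-polynomial m = m , 0 , λ _ → ℕ.≤-reflexive (sym (ℕ.*-identityʳ m))

+-polynomial : ∀ {s t} → Polynomial s → Polynomial t → Polynomial (λ n → s n + t n)
+-polynomial {s} {t} (c , k , s≤) (d , l , t≤) = c + d , k + l , λ n → begin
  s n + t n                                   ≤⟨ ℕ.+-mono-≤ (s≤ n) (t≤ n) ⟩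
  c * suc n ^ k + d * suc n ^ l
    ≤⟨ ℕ.+-mono-≤ (ℕ.*-monoʳ-≤ c (ℕ.^-monoʳ-≤ (suc n) (ℕ.m≤m+n k l)))
                  (ℕ.*-monoʳ-≤ d (ℕ.^-monoʳ-≤ (suc n) (ℕ.m≤n+m l k))) ⟩
  c * suc n ^ (k + l) + d * suc n ^ (k + l)   ≡⟨ ℕ.*-distribʳ-+ (suc n ^ (k + l)) c d ⟨
  (c + d) * suc n ^ (k + l)                   ∎
  where open ℕ.≤-Reasoning

n*-polynomial : ∀ {t} → Polynomial t → Polynomial (λ n → n * t n)
n*-polynomial {t} (c , k , t≤) = c , suc k , λ n → begin
  n * t n                   ≤⟨ ℕ.*-mono-≤ (ℕ.n≤1+n n) (t≤ n) ⟩
  suc n * (c * suc n ^ k)   ≡⟨ ℕ.*-assoc (suc n) c (suc n ^ k) ⟨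
  suc n * c * suc n ^ k     ≡⟨ cong (_* suc n ^ k) (ℕ.*-comm (suc n) c) ⟩
  c * suc n * suc n ^ k     ≡⟨ ℕ.*-assoc c (suc n) (suc n ^ k) ⟩
  c * suc n ^ suc k         ∎
  where open ℕ.≤-Reasoning

-- Stack programs

-- Programs with a single variable, which holds a stack: a command acts on the
-- topmost tree and leaves the rest r alone.
Run : Cmd 1 → Tree → Tree → ℕ → Set
Run c x y t = ∀ r → ∃[ s ] s ≤ t × ⟨ c , (x ∙ r) ∷ [] ⟩⇓ (y ∙ r) ∷ [] [ s ]

v : Exp 1
v = var 0F

-- Substitutes `hd v` for the variable, so that an expression written for a single tree acts on the
-- top of the stack.
top : Exp 1 → Exp 1
top (var 0F)   = hd v
top nil        = nil
top (cons a b) = cons (top a) (top b)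
top (hd a)     = hd (top a)
top (tl a)     = tl (top a)

eval-top : ∀ e x r → eval (top e) ((x ∙ r) ∷ []) ≡ eval e (x ∷ [])
eval-top (var 0F)   x r = refl
eval-top nil        x r = refl
eval-top (cons a b) x r = cong₂ _∙_ (eval-top a x r) (eval-top b x r)
eval-top (hd a)     x r = cong head (eval-top a x r)
eval-top (tl a)     x r = cong tail (eval-top a x r)

exp : Exp 1 → Cmd 1
exp e = 0F ≔ cons (top e) (tl v)

expTime : Exp 1 → ℕ
expTime e = 1 + cost (cons (top e) (tl v))

exp-run : ∀ e x → Run (exp e) x (eval e (x ∷ [])) (expTime e)
exp-run e x r =
  _ , ℕ.≤-refl ,
  subst (λ y → ⟨ exp e , (x ∙ r) ∷ [] ⟩⇓ (y ∙ r) ∷ [] [ _ ]) (eval-top e x r) assign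

seq-run : ∀ {c d x y z s t} → Run c x y s → Run d y z t → Run (c ⨾ d) x z (s + t)
seq-run p q r =
  let (_ , s≤ , c⇓) = p r
      (_ , t≤ , d⇓) = q r
  in _ , ℕ.+-mono-≤ s≤ t≤ , seq c⇓ d⇓

weaken-run : ∀ {c x y s t} → s ≤ t → Run c x y s → Run c x y t
weaken-run s≤t p r =
  let (_ , ≤s , c⇓) = p r in _ , ℕ.≤-trans ≤s s≤t , c⇓

-- `push` turns the stack `(x ∙ z) ∙ r` into `x ∙ z ∙ r`, and `pull` undoes this. In between, `z`
-- belongs to the rest of the stack, which a command leaves alone.
push pull : Cmd 1
push = 0F ≔ cons (hd (hd v)) (cons (tl (hd v)) (tl v))
pull = 0F ≔ cons (cons (hd v) (hd (tl v))) (tl (tl v))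

first : Cmd 1 → Cmd 1
first c = push ⨾ (c ⨾ pull)

-- An execution of push or pull takes time 11.
firstTime : ℕ → ℕ
firstTime t = 11 + (t + 11)

first-run : ∀ {c x y t} z → Run c x y t → Run (first c) (x ∙ z) (y ∙ z) (firstTime t)
first-run z p r =
  let (_ , ≤t , c⇓) = p (z ∙ r)
  in _ , ℕ.+-monoʳ-≤ 11 (ℕ.+-monoˡ-≤ 11 ≤t) , seq assign (seq c⇓ assign)

branch : ∀ {A : Set} → Tree → A → A → A
branch nil     y z = z
branch (_ ∙ _) y z = y

ifᶜ : Exp 1 → Cmd 1 → Cmd 1 → Cmd 1
ifᶜ e c d = if top e then c else d

-- Adding the times of both branches gives a bound that does not depend on the outcome of the test.
if-run : ∀ e {c d x y z s t} → Run c x y s → Run d x z t →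
         Run (ifᶜ e c d) x (branch (eval e (x ∷ [])) y z) (1 + cost (top e) + (s + t))
if-run e {c} {d} {x} {y} {z} {s} {t} p q r with eval e (x ∷ []) | eval-top e x r
... | nil   | eq =
  let (_ , ≤t , d⇓) = q r
  in _ , ℕ.+-monoʳ-≤ (1 + cost (top e)) (ℕ.≤-trans ≤t (ℕ.m≤n+m t s)) , ifFalse eq d⇓
... | _ ∙ _ | eq =
  let (_ , ≤s , c⇓) = p r
  in _ , ℕ.+-monoʳ-≤ (1 + cost (top e)) (ℕ.≤-trans ≤s (ℕ.m≤m+n s t)) ,
     ifTrue (λ eq′ → contradiction (trans (sym eq) eq′) λ ()) c⇓

-- Folds over encoded lists

guard : Exp 1
guard = top (tl v)

foldStep : Exp 1
foldStep = cons (cons (hd v) (hd (tl v))) (tl (tl v))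

-- From a ∙ l, the loop feeds c with (current accumulator) ∙ (next element of l).
foldLoop foldᶜ : Cmd 1 → Cmd 1
foldLoop c = while guard (exp foldStep ⨾ first c)
foldᶜ c = foldLoop c ⨾ exp (hd v)

foldBodyTime : ℕ → ℕ
foldBodyTime t = 1 + cost guard + (expTime foldStep + firstTime t)

foldLoop-nil : ∀ c a → Run (foldLoop c) (a ∙ nil) (a ∙ nil) (1 + cost guard)
foldLoop-nil c a r = _ , ℕ.≤-refl , exit refl

foldLoop-cons : ∀ {c a x b l y s t} → Run c (a ∙ x) b s → Run (foldLoop c) (b ∙ l) y t →
                Run (foldLoop c) (a ∙ x ∙ l) y (foldBodyTime s + t)
foldLoop-cons {a = a} {x} {b} {l} p q r =
  let (_ , ≤s , c⇓) = seq-run (exp-run foldStep (a ∙ x ∙ l)) (first-run l p) r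
      (_ , ≤t , d⇓) = q r
  in _ , ℕ.+-mono-≤ (ℕ.+-monoʳ-≤ (1 + cost guard) ≤s) ≤t , loop (λ ()) c⇓ d⇓

list : ∀ {m} → (Fin m → Tree) → Tree
list g = encodeList (tabulate g)

loopTime foldTime : ℕ → ℕ → ℕ
loopTime m t = m * foldBodyTime t + (1 + cost guard)
foldTime m t = loopTime m t + expTime (hd v)

fold-run : ∀ {c a l b} m t → Run (foldLoop c) (a ∙ l) (b ∙ nil) (loopTime m t) →
           Run (foldᶜ c) (a ∙ l) b (foldTime m t)
fold-run {b = b} m t p = seq-run p (exp-run (hd v) (b ∙ nil))

foldLoop-suc : ∀ {c a x b l y t} m → Run c (a ∙ x) b t →
               Run (foldLoop c) (b ∙ l) y (loopTime m t) →
               Run (foldLoop c) (a ∙ x ∙ l) y (loopTime (suc m) t)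
foldLoop-suc {t = t} m p q =
  weaken-run (ℕ.≤-reflexive (sym (ℕ.+-assoc (foldBodyTime t) (m * foldBodyTime t) _)))
             (foldLoop-cons p q)

any : ∀ {m} → (Fin m → Bool) → Bool
any {zero}  g = false
any {suc m} g = g zero ∨ any (g ∘ suc)

bools : ∀ {m} → (Fin m → Bool) → Tree
bools g = list (encodeBool ∘ g)

orᶜ anyᶜ : Cmd 1
orᶜ = ifᶜ (hd v) (exp (hd v)) (exp (tl v))
anyᶜ = exp (cons nil v) ⨾ foldᶜ orᶜ

-- The time is chosen before the arguments, hence uniform; the split on `a` lets `branch` reduce.
or-run : ∃[ t ] ∀ a b → Run orᶜ (encodeBool a ∙ encodeBool b) (encodeBool (a ∨ b)) t
or-run = _ , λ where
  false b → if-run (hd v) (exp-run (hd v) _) (exp-run (tl v) _)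
  true  b → if-run (hd v) (exp-run (hd v) _) (exp-run (tl v) _)

orTime : ℕ
orTime = let (t , _) = or-run in t

-- The initial accumulator is arbitrary because the induction continues with `a ∨ g zero`.
anyLoop-run : ∀ m a (g : Fin m → Bool) →
              Run (foldLoop orᶜ) (encodeBool a ∙ bools g) (encodeBool (a ∨ any g) ∙ nil)
                  (loopTime m orTime)
anyLoop-run zero    false g = foldLoop-nil orᶜ _
anyLoop-run zero    true  g = foldLoop-nil orᶜ _
anyLoop-run (suc m) a     g
  rewrite sym (∨-assoc a (g zero) (any (g ∘ suc))) =
  let (_ , run) = or-run
  in foldLoop-suc m (run a (g zero)) (anyLoop-run m (a ∨ g zero) (g ∘ suc))

anyTime : ℕ → ℕ
anyTime m = expTime (cons nil v) + foldTime m orTime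

any-run : ∀ {m} (g : Fin m → Bool) → Run anyᶜ (bools g) (encodeBool (any g)) (anyTime m)
any-run {m} g =
  seq-run (exp-run (cons nil v) (bools g)) (fold-run m orTime (anyLoop-run m false g))

revOnto : ∀ {m} → (Fin m → Tree) → Tree → Tree
revOnto {zero}  g out = out
revOnto {suc m} g out = revOnto (g ∘ suc) (g zero ∙ out)

append : ∀ {m} → (Fin m → Tree) → Tree → Tree
append {zero}  g out = out
append {suc m} g out = g zero ∙ append (g ∘ suc) out

append-nil : ∀ {m} (g : Fin m → Tree) → append g nil ≡ list g
append-nil {zero}  g = refl
append-nil {suc m} g = cong (g zero ∙_) (append-nil (g ∘ suc))

consᶜ reverseᶜ : Cmd 1
consᶜ = exp (cons (tl v) (hd v))
reverseᶜ = exp (cons nil v) ⨾ foldᶜ consᶜ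

consTime : ℕ
consTime = expTime (cons (tl v) (hd v))

-- `revOnto` puts `g zero` last, right before `l`. So the induction first lets the loop consume the
-- other elements, and the remaining run is passed along as a continuation, to which one iteration
-- for `g zero` is prepended.
reverseLoop-run : ∀ m {t y l out} (g : Fin m → Tree) →
                  Run (foldLoop consᶜ) (append g out ∙ l) y t →
                  Run (foldLoop consᶜ) (out ∙ revOnto g l) y (m * foldBodyTime consTime + t)
reverseLoop-run zero g p = p
reverseLoop-run (suc m) {t} g p =
  weaken-run (ℕ.≤-reflexive (trans (sym (ℕ.+-assoc (m * k) k t)) (cong (_+ t) (ℕ.+-comm (m * k) k))))
    (reverseLoop-run m (g ∘ suc) (foldLoop-cons (exp-run (cons (tl v) (hd v)) _) p))
  where k = foldBodyTime consTime

reverseTime : ℕ → ℕ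
reverseTime m = expTime (cons nil v) + foldTime m consTime

reverse-run : ∀ {m} (g : Fin m → Tree) → Run reverseᶜ (revOnto g nil) (list g) (reverseTime m)
reverse-run {m} g =
  seq-run (exp-run (cons nil v) _)
    (fold-run m consTime (reverseLoop-run m g
      (subst (λ l → Run (foldLoop consᶜ) (append g nil ∙ nil) (l ∙ nil) (1 + cost guard))
             (append-nil g) (foldLoop-nil consᶜ _))))

-- The accumulator of the fold is out ∙ ctx ∙ hs, where out lists the results
-- so far in reverse order and hs is the rest of the second list.
zipCall zipReturn zipInit : Exp 1
zipCall   = cons (cons (hd (tl (hd v))) (cons (tl v) (hd (tl (tl (hd v))))))
                 (cons (hd (hd v)) (cons (hd (tl (hd v))) (tl (tl (tl (hd v))))))
zipReturn = cons (cons (hd v) (hd (tl v))) (tl (tl v))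
zipInit   = cons (cons nil (cons (hd v) (tl (tl v)))) (hd (tl v))

-- Each call of `c` gets its own copy of `ctx`, since it overwrites its argument. The final
-- `reverseᶜ` restores the order of the results.
zipBody zipᶜ : Cmd 1 → Cmd 1
zipBody c = exp zipCall ⨾ first c ⨾ exp zipReturn
zipᶜ c = exp zipInit ⨾ foldᶜ (zipBody c) ⨾ exp (hd v) ⨾ reverseᶜ

zipBodyTime : ℕ → ℕ
zipBodyTime t = expTime zipCall + (firstTime t + expTime zipReturn)

zipBody-run : ∀ {c ctx x h y t} out hs → Run c (ctx ∙ x ∙ h) y t →
              Run (zipBody c) ((out ∙ ctx ∙ h ∙ hs) ∙ x) ((y ∙ out) ∙ ctx ∙ hs) (zipBodyTime t)
zipBody-run out hs p =
  seq-run (exp-run zipCall _) (seq-run (first-run _ p) (exp-run zipReturn _))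

zipLoop-run : ∀ m {c ctx t out} (g h o : Fin m → Tree) →
              (∀ i → Run c (ctx ∙ g i ∙ h i) (o i) t) →
              Run (foldLoop (zipBody c)) ((out ∙ ctx ∙ list h) ∙ list g)
                  ((revOnto o out ∙ ctx ∙ nil) ∙ nil)
                  (loopTime m (zipBodyTime t))
zipLoop-run zero    g h o p = foldLoop-nil _ _
zipLoop-run (suc m) g h o p =
  foldLoop-suc m (zipBody-run _ _ (p zero))
    (zipLoop-run m (g ∘ suc) (h ∘ suc) (o ∘ suc) (p ∘ suc))

zipTime : ℕ → ℕ → ℕ
zipTime m t = expTime zipInit + (foldTime m (zipBodyTime t) + (expTime (hd v) + reverseTime m))

zip-run : ∀ {m c ctx t} {g h o : Fin m → Tree} →
          (∀ i → Run c (ctx ∙ g i ∙ h i) (o i) t) →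
          Run (zipᶜ c) (ctx ∙ list g ∙ list h) (list o) (zipTime m t)
zip-run {m} {t = t} {g} {h} {o} p =
  seq-run (exp-run zipInit _)
    (seq-run (fold-run m (zipBodyTime t) (zipLoop-run m g h o p))
      (seq-run (exp-run (hd v) _) (reverse-run o)))

-- The list serves only as a counter: `exp (hd v)` discards its elements.
iterᶜ : Cmd 1 → Cmd 1
iterᶜ c = foldᶜ (exp (hd v) ⨾ c)

iterLoop-run : ∀ m {A : Set} {c t} (enc : A → Tree) (f : A → A) (g : Fin m → Tree) →
               (∀ a → Run c (enc a) (enc (f a)) t) → ∀ a →
               Run (foldLoop (exp (hd v) ⨾ c)) (enc a ∙ list g) (enc (iterate f a m) ∙ nil)
                   (loopTime m (expTime (hd v) + t))
iterLoop-run zero    enc f g p a = foldLoop-nil _ _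
iterLoop-run (suc m) enc f g p a =
  foldLoop-suc m (seq-run (exp-run (hd v) _) (p a)) (iterLoop-run m enc f (g ∘ suc) p (f a))

iter-run : ∀ {m A c t} (enc : A → Tree) (f : A → A) (g : Fin m → Tree) →
           (∀ a → Run c (enc a) (enc (f a)) t) → ∀ a →
           Run (iterᶜ c) (enc a ∙ list g) (enc (iterate f a m)) (foldTime m (expTime (hd v) + t))
iter-run {m} {t = t} enc f g p a = fold-run m (expTime (hd v) + t) (iterLoop-run m enc f g p a)

-- Commands on families of inputs, with polynomial time bounds

record Routine {I : ℕ → Set} (c : Cmd 1) (f g : ∀ {n} → I n → Tree) : Set where
  constructor routine
  field
    {time}     : ℕ → ℕ
    polynomial : Polynomial time
    run        : ∀ {n} (i : I n) → Run c (f i) (g i) (time n)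

foldBody-polynomial : ∀ {t} → Polynomial t → Polynomial (λ n → foldBodyTime (t n))
foldBody-polynomial p =
  +-polynomial (const-polynomial (1 + cost guard))
    (+-polynomial (const-polynomial (expTime foldStep))
      (+-polynomial (const-polynomial 11) (+-polynomial p (const-polynomial 11))))

fold-polynomial : ∀ {t} → Polynomial t → Polynomial (λ n → foldTime n (t n))
fold-polynomial p =
  +-polynomial
    (+-polynomial (n*-polynomial (foldBody-polynomial p)) (const-polynomial (1 + cost guard)))
    (const-polynomial (expTime (hd v)))

module _ {I : ℕ → Set} where

  expʳ : ∀ e (f : ∀ {n} → I n → Tree) → Routine {I} (exp e) f (λ i → eval e (f i ∷ []))
  expʳ e f = routine (const-polynomial (expTime e)) (λ i → exp-run e (f i))

  infixr 5 _⨾ʳ_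

  _⨾ʳ_ : ∀ {c d} {f g h : ∀ {n} → I n → Tree} →
         Routine {I} c f g → Routine {I} d g h → Routine {I} (c ⨾ d) f h
  routine p c-run ⨾ʳ routine q d-run =
    routine (+-polynomial p q) (λ i → seq-run (c-run i) (d-run i))

  firstʳ : ∀ {c} {f g : ∀ {n} → I n → Tree} (h : ∀ {n} → I n → Tree) → Routine {I} c f g →
           Routine {I} (first c) (λ i → f i ∙ h i) (λ i → g i ∙ h i)
  firstʳ h (routine p c-run) =
    routine (+-polynomial (const-polynomial 11) (+-polynomial p (const-polynomial 11)))
            (λ i → first-run (h i) (c-run i))

  ifʳ : ∀ e {c d} {f g h : ∀ {n} → I n → Tree} →
        Routine {I} c f g → Routine {I} d f h →
        Routine {I} (ifᶜ e c d) f (λ i → branch (eval e (f i ∷ [])) (g i) (h i))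
  ifʳ e (routine p c-run) (routine q d-run) =
    routine (+-polynomial (const-polynomial (1 + cost (top e))) (+-polynomial p q))
            (λ i → if-run e (c-run i) (d-run i))

  -- The inner family carries the position as well, so its time bound is uniform over all positions;
  -- nesting two zips reaches the entries of a matrix.
  zipʳ : ∀ {c} {ctx : ∀ {n} → I n → Tree} {g h o : ∀ {n} → I n → Fin n → Tree} →
         Routine {λ n → I n × Fin n} c
           (λ (i , j) → ctx i ∙ g i j ∙ h i j) (λ (i , j) → o i j) →
         Routine {I} (zipᶜ c) (λ i → ctx i ∙ list (g i) ∙ list (h i)) (λ i → list (o i))
  zipʳ (routine p c-run) =
    routine
      (+-polynomial (const-polynomial (expTime zipInit))
        (+-polynomial
          (fold-polynomial
            (+-polynomial (const-polynomial (expTime zipCall))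
              (+-polynomial
                (+-polynomial (const-polynomial 11) (+-polynomial p (const-polynomial 11)))
                (const-polynomial (expTime zipReturn)))))
          (+-polynomial (const-polynomial (expTime (hd v)))
            (+-polynomial (const-polynomial (expTime (cons nil v)))
              (fold-polynomial (const-polynomial consTime))))))
      (λ i → zip-run (λ j → c-run (i , j)))

  anyʳ : (g : ∀ {n} → I n → Fin n → Bool) →
         Routine {I} anyᶜ (λ i → bools (g i)) (λ i → encodeBool (any (g i)))
  anyʳ g =
    routine (+-polynomial (const-polynomial (expTime (cons nil v)))
                          (fold-polynomial (const-polynomial orTime)))
            (λ i → any-run (g i))

  -- Replaces the nested `branch` terms produced by `ifʳ` with the intended value.
  outputʳ : ∀ {c} {f g h : ∀ {n} → I n → Tree} → (∀ {n} (i : I n) → g i ≡ h i) →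
            Routine {I} c f g → Routine {I} c f h
  outputʳ g≡h (routine p c-run) =
    routine p (λ {n} i → subst (λ y → Run _ _ y _) (g≡h i) (c-run i))

-- The body is bounded uniformly over `A n`, as it runs on all the iterates and not just on the
-- start value `a i`.
iterʳ : ∀ {c} {I : ℕ → Set} {A : ℕ → Set} (enc : ∀ {n} → A n → Tree) {f : ∀ {n} → A n → A n}
        (a : ∀ {n} → I n → A n) (g : ∀ {n} → I n → Fin n → Tree) →
        Routine {A} c enc (λ x → enc (f x)) →
        Routine {I} (iterᶜ c) (λ i → enc (a i) ∙ list (g i))
                              (λ {n} i → enc (iterate f (a i) n))
iterʳ enc {f} a g (routine p c-run) =
  routine (fold-polynomial (+-polynomial (const-polynomial (expTime (hd v))) p))
          (λ i → iter-run enc f (g i) c-run (a i))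

-- The decision procedure

Matrix : Set → ℕ → Set
Matrix A n = Fin n → Fin n → A

matrix : {A : Set} {n : ℕ} → (A → Tree) → Matrix A n → Tree
matrix enc M = list λ u → list λ w → enc (M u w)

bitMatrix : ∀ {n} → Matrix Bool n → Tree
bitMatrix = matrix encodeBool

-- R ∨ R Rᵀ: the scalar product of two rows is easier to program than a matrix
-- product, and R is symmetric whenever this is used.
square : ∀ {n} → Matrix Bool n → Matrix Bool n
square R u w = any (λ z → R u z ∧ R w z) ∨ R u w

-- Writing `Rᵤ` for row `u` of `R`: the outer zip runs over the pairs `(Rᵤ , Rᵤ)` with context `R`,
-- and `squareRow` makes of this a zip of the entries of `Rᵤ` with the rows of `R`, in context `Rᵤ`.
-- Thus `dotOrᶜ` receives `Rᵤ`, the entry at `(u , w)` and `R_w`; `dotInit` sets the entry aside.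
dotInit squareInit squareRow : Exp 1
dotInit    = cons (cons nil (cons (hd v) (tl (tl v)))) (hd (tl v))
squareInit = cons v (cons v v)
squareRow  = cons (hd (tl v)) (cons (hd (tl v)) (hd v))

andᶜ dotOrᶜ squareᶜ : Cmd 1
andᶜ = ifᶜ (hd (tl v)) (exp (tl (tl v))) (exp nil)
dotOrᶜ = exp dotInit ⨾ first (zipᶜ andᶜ ⨾ anyᶜ) ⨾ orᶜ
squareᶜ = exp squareInit ⨾ zipᶜ (exp squareRow ⨾ zipᶜ dotOrᶜ)

orʳ : {I : ℕ → Set} (a b : ∀ {n} → I n → Bool) →
      Routine {I} orᶜ (λ i → encodeBool (a i) ∙ encodeBool (b i)) (λ i → encodeBool (a i ∨ b i))
orʳ a b = let (t , run) = or-run in routine (const-polynomial t) (λ i → run (a i) (b i))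

andʳ : {I : ℕ → Set} (a b : ∀ {n} → I n → Bool) →
       Routine {I} andᶜ (λ i → nil ∙ encodeBool (a i) ∙ encodeBool (b i))
                        (λ i → encodeBool (a i ∧ b i))
andʳ a b = outputʳ (λ i → eq (a i) (b i)) (ifʳ (hd (tl v)) (expʳ (tl (tl v)) _) (expʳ nil _))
  where
  eq : ∀ a b → branch (encodeBool a) (encodeBool b) nil ≡ encodeBool (a ∧ b)
  eq false b = refl
  eq true  b = refl

dotOrʳ : {I : ℕ → Set} (a b : ∀ {n} → I n → Fin n → Bool) (c : ∀ {n} → I n → Bool) →
         Routine {I} dotOrᶜ (λ i → bools (a i) ∙ encodeBool (c i) ∙ bools (b i))
                            (λ i → encodeBool (any (λ z → a i z ∧ b i z) ∨ c i))
dotOrʳ a b c =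
  expʳ dotInit _ ⨾ʳ
  firstʳ (λ i → encodeBool (c i))
    (zipʳ (andʳ (λ (i , z) → a i z) (λ (i , z) → b i z)) ⨾ʳ anyʳ (λ i z → a i z ∧ b i z)) ⨾ʳ
  orʳ (λ i → any (λ z → a i z ∧ b i z)) c

squareʳ : Routine {Matrix Bool} squareᶜ bitMatrix (λ R → bitMatrix (square R))
squareʳ =
  expʳ squareInit _ ⨾ʳ
  zipʳ (expʳ squareRow _ ⨾ʳ
        zipʳ (dotOrʳ (λ ((R , u) , w) → R u) (λ ((R , u) , w) → R w) (λ ((R , u) , w) → R u w)))

Entry : Set
Entry = Bool × Bool × Maybe (Fin 2)

encodeEntry : Entry → Tree
encodeEntry (a , b , l) = encodeBool a ∙ encodeBool b ∙ encodeLabel l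

isZero : Maybe (Fin 2) → Bool
isZero (just 0F) = true
isZero _         = false

zeroEntry : Entry → Bool
zeroEntry (a , _ , l) = a ∧ isZero l

-- Here `r` stands for connection by edges of `G` labeled 0.
contradicts : Bool → Entry → Bool
contradicts r (_ , _ , nothing) = false
contradicts r (_ , _ , just 0F) = not r
contradicts r (_ , _ , just 1F) = r

-- With `n` squarings, the rows of the input matrix can serve as the counter of `iterᶜ`.
closure : ∀ {n} → Matrix Bool n → Matrix Bool n
closure {n} R = iterate square R n

zeros : ∀ {n} → Matrix Entry n → Matrix Bool n
zeros M u w = zeroEntry (M u w)

accepts : ∀ {n} → Matrix Entry n → Bool
accepts M = not (any λ u → any λ w → contradicts (closure (zeros M) u w) (M u w))

-- The argument is `nil ∙ y ∙ encodeEntry e`: an empty context and the two zipped elements. For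
-- `zeroᶜ`, `y` is a second copy of the entry; for `contradictsᶜ`, it is the bit of the closure.
trueᵉ isEdge label : Exp 1
trueᵉ  = cons nil nil
isEdge = hd (tl (tl v))
label  = tl (tl (tl (tl v)))

zeroᶜ contradictsᶜ notᶜ : Cmd 1
zeroᶜ =
  ifᶜ isEdge
    -- `label` is nil if there is none; otherwise its head is nil for 0 and not nil for 1.
    (ifᶜ label (ifᶜ (hd label) (exp nil) (exp trueᵉ)) (exp nil))
    (exp nil)
contradictsᶜ =
  ifᶜ label
    (ifᶜ (hd label) (exp (hd (tl v))) (ifᶜ (hd (tl v)) (exp nil) (exp trueᵉ)))
    (exp nil)
notᶜ = ifᶜ v (exp nil) (exp trueᵉ)

zeroʳ : {I : ℕ → Set} (e : ∀ {n} → I n → Entry) →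
        Routine {I} zeroᶜ (λ i → nil ∙ encodeEntry (e i) ∙ encodeEntry (e i))
                          (λ i → encodeBool (zeroEntry (e i)))
zeroʳ {I} e = outputʳ (λ i → eq (e i))
  (ifʳ isEdge (ifʳ label (ifʳ (hd label) (expʳ nil _) (expʳ trueᵉ _)) (expʳ nil _)) (expʳ nil _))
  where
  eq : ∀ e → branch (head (encodeEntry e))
               (branch (tail (tail (encodeEntry e)))
                 (branch (head (tail (tail (encodeEntry e)))) nil (nil ∙ nil)) nil)
               nil ≡ encodeBool (zeroEntry e)
  eq (false , _ , _)       = refl
  eq (true , _ , nothing)  = refl
  eq (true , _ , just 0F)  = refl
  eq (true , _ , just 1F)  = refl

contradictsʳ : {I : ℕ → Set} (r : ∀ {n} → I n → Bool) (e : ∀ {n} → I n → Entry) →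
               Routine {I} contradictsᶜ (λ i → nil ∙ encodeBool (r i) ∙ encodeEntry (e i))
                                        (λ i → encodeBool (contradicts (r i) (e i)))
contradictsʳ r e = outputʳ (λ i → eq (r i) (e i))
  (ifʳ label
    (ifʳ (hd label) (expʳ (hd (tl v)) _) (ifʳ (hd (tl v)) (expʳ nil _) (expʳ trueᵉ _)))
    (expʳ nil _))
  where
  eq : ∀ r e → branch (tail (tail (encodeEntry e)))
                 (branch (head (tail (tail (encodeEntry e)))) (encodeBool r)
                   (branch (encodeBool r) nil (nil ∙ nil))) nil
               ≡ encodeBool (contradicts r e)
  eq r     (_ , _ , nothing) = refl
  eq false (_ , _ , just 0F) = refl
  eq true  (_ , _ , just 0F) = refl
  eq r     (_ , _ , just 1F) = refl

notʳ : {I : ℕ → Set} (a : ∀ {n} → I n → Bool) →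
       Routine {I} notᶜ (λ i → encodeBool (a i)) (λ i → encodeBool (not (a i)))
notʳ a = outputʳ (λ i → eq (a i)) (ifʳ v (expʳ nil _) (expʳ trueᵉ _))
  where
  eq : ∀ a → branch (encodeBool a) nil (nil ∙ nil) ≡ encodeBool (not a)
  eq false = refl
  eq true  = refl

-- The input matrix is kept beside the intermediate results: it is zipped with itself to find the
-- 0-edges, counts the squarings, and is finally compared with the closure.
zerosInit closureInit compareInit : Exp 1
zerosInit   = cons (cons nil (cons v v)) v
closureInit = cons v (tl v)
compareInit = cons nil v

acceptsᶜ : Cmd 1
acceptsᶜ =
  exp zerosInit ⨾ first (zipᶜ (zipᶜ zeroᶜ)) ⨾
  exp closureInit ⨾ first (iterᶜ squareᶜ) ⨾
  exp compareInit ⨾ zipᶜ (zipᶜ contradictsᶜ ⨾ anyᶜ) ⨾ anyᶜ ⨾ notᶜ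

acceptsʳ : Routine {Matrix Entry} acceptsᶜ (matrix encodeEntry) (λ M → encodeBool (accepts M))
acceptsʳ =
  expʳ zerosInit _ ⨾ʳ
  firstʳ (matrix encodeEntry) (zipʳ (zipʳ (zeroʳ (λ ((M , u) , w) → M u w)))) ⨾ʳ
  expʳ closureInit _ ⨾ʳ
  firstʳ (matrix encodeEntry)
    (iterʳ bitMatrix zeros (λ M u → list λ w → encodeEntry (M u w)) squareʳ) ⨾ʳ
  expʳ compareInit _ ⨾ʳ
  zipʳ (zipʳ (contradictsʳ (λ ((M , u) , w) → closure (zeros M) u w)
                           (λ ((M , u) , w) → M u w)) ⨾ʳ
        anyʳ (λ (M , u) w → contradicts (closure (zeros M) u w) (M u w))) ⨾ʳ
  anyʳ (λ M u → any λ w → contradicts (closure (zeros M) u w) (M u w)) ⨾ʳ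
  notʳ _

instanceMatrix : (I : Instance) → Matrix Entry (Instance.n I)
instanceMatrix I u w =
  adj G u w , adj G′ u w , (edgeBetween G′ u w >>= x̃)
  where
  open Instance I

list-size : ∀ {m} (g : Fin m → Tree) → suc m ≤ size (list g)
list-size {zero}  g = s≤s z≤n
list-size {suc m} g = s≤s (ℕ.≤-trans (list-size (g ∘ suc)) (ℕ.m≤n+m _ (size (g zero))))

-- The first assignment makes the input the top of an otherwise empty stack, and the last one takes
-- the output off it.
program : Program
program = record { extra = 0 ; body = 0F ≔ cons v nil ⨾ (acceptsᶜ ⨾ 0F ≔ hd v) }

program-runs : Σ[ c ∈ ℕ ] Σ[ k ∈ ℕ ] ((I : Instance) → ∃[ t ]
                 Runs program (encode I) (encodeBool (accepts (instanceMatrix I))) t ×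
                 t ≤ c * size (encode I) ^ k)
program-runs =
  let routine p run = acceptsʳ
      -- 4 and 3 are the times of the first and the last assignment of `program`.
      (c , k , bound) = +-polynomial (const-polynomial 4) (+-polynomial p (const-polynomial 3))
  in c , k , λ I →
    let (s , s≤ , c⇓) = run (instanceMatrix I) nil
    in 4 + (s + 3) , (_ , seq assign (seq c⇓ assign) , refl) ,
       ℕ.≤-trans (ℕ.+-monoʳ-≤ 4 (ℕ.+-monoˡ-≤ 3 s≤))
         (ℕ.≤-trans (bound (Instance.n I))
           (ℕ.*-monoʳ-≤ c (ℕ.^-monoˡ-≤ k (list-size λ u → list λ w → encodeEntry (instanceMatrix I u w)))))

-- Connectedness in graphs

T-any : ∀ {m} (g : Fin m → Bool) → T (any g) → ∃[ i ] T (g i)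
T-any {suc m} g t with Equivalence.to (T-∨ {g zero}) t
... | inj₁ t₀ = zero , t₀
... | inj₂ t₁ = let (i , tᵢ) = T-any (g ∘ suc) t₁ in suc i , tᵢ

any-T : ∀ {m} (g : Fin m → Bool) i → T (g i) → T (any g)
any-T g zero    t = Equivalence.from (T-∨ {g zero}) (inj₁ t)
any-T g (suc i) t = Equivalence.from (T-∨ {g zero}) (inj₂ (any-T (g ∘ suc) i t))

module _ {n} (R : Matrix Bool n) where

  square-elim : ∀ u w → T (square R u w) → (∃[ z ] T (R u z) × T (R w z)) ⊎ T (R u w)
  square-elim u w t with Equivalence.to (T-∨ {any λ z → R u z ∧ R w z}) t
  ... | inj₂ uw = inj₂ uw
  ... | inj₁ t′ =
    let (z , uzw) = T-any (λ z → R u z ∧ R w z) t′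
    in inj₁ (z , Equivalence.to (T-∧ {R u z}) uzw)

  square-intro : ∀ u w z → T (R u z) → T (R w z) → T (square R u w)
  square-intro u w z uz wz =
    Equivalence.from (T-∨ {any λ z → R u z ∧ R w z})
      (inj₁ (any-T (λ z → R u z ∧ R w z) z (Equivalence.from (T-∧ {R u z}) (uz , wz))))

  square-extends : ∀ u w → T (R u w) → T (square R u w)
  square-extends u w uw = Equivalence.from (T-∨ {any λ z → R u z ∧ R w z}) (inj₂ uw)

Symmetric : ∀ {n} → Matrix Bool n → Set
Symmetric R = ∀ u w → T (R u w) → T (R w u)

square-symmetric : ∀ {n} (R : Matrix Bool n) → Symmetric R → Symmetric (square R)
square-symmetric R s u w t with square-elim R u w t
... | inj₁ (z , uz , wz) = square-intro R w u z wz uz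
... | inj₂ uw            = square-extends R w u (s u w uw)

-- Pigeonhole principle: `lookup` is injective on a list without repetitions.
unique-length : ∀ {m} {xs : List (Fin m)} → Unique xs → length xs ≤ m
unique-length {xs = xs} u = injective⇒≤ (lookup-injective u)
  where
  lookup-injective : ∀ {xs} → Unique xs → ∀ {i j} → lookup xs i ≡ lookup xs j → i ≡ j
  lookup-injective (_ ∷ _)   {zero}  {zero}  eq = refl
  lookup-injective (x≢ ∷ _)  {zero}  {suc j} eq = contradiction eq (All.lookup x≢ (∈-lookup j))
  lookup-injective (x≢ ∷ _)  {suc i} {zero}  eq = contradiction (sym eq) (All.lookup x≢ (∈-lookup i))
  lookup-injective (_ ∷ u)   {suc i} {suc j} eq = cong suc (lookup-injective u eq)

joins-sym : ∀ {n} {G : Graph n} {e : Edge G} {u w} → Joins e u w → Joins e w u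
joins-sym forward  = backward
joins-sym backward = forward

edgeBetween-joins : ∀ {n} (G : Graph n) u w {e} → edgeBetween G u w ≡ just e → Joins e u w
edgeBetween-joins G u w eq with <-cmp u w | T? (adj G u w) | T? (adj G w u)
edgeBetween-joins G u w refl | tri< _ _ _ | yes _ | _     = forward
edgeBetween-joins G u w refl | tri> _ _ _ | yes _ | yes _ = backward
edgeBetween-joins G u w refl | tri> _ _ _ | no _  | yes _ = backward

joins-edgeBetween : ∀ {n} (G : Graph n) {e u w} → Joins e u w → edgeBetween G u w ≡ just e
joins-edgeBetween G {edge u w u<w uw} forward
  with <-cmp u w | T? (adj G u w) | T? (adj G w u)
... | tri< _ _ _   | yes _ | _ = refl
... | tri< _ _ _   | no ¬p | _ = contradiction-irr uw ¬p
... | tri≈ u≮w _ _ | _     | _ = contradiction-irr u<w u≮w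
... | tri> u≮w _ _ | _     | _ = contradiction-irr u<w u≮w
joins-edgeBetween G {edge u w u<w uw} backward
  with <-cmp w u | T? (adj G w u) | T? (adj G u w)
... | tri> _ _ _   | yes _ | yes _ = refl
... | tri> _ _ _   | no _  | yes _ = refl
... | tri> _ _ _   | _     | no ¬p = contradiction-irr uw ¬p
... | tri≈ _ _ u≮w | _     | _     = contradiction-irr u<w u≮w
... | tri< _ _ u≮w | _     | _     = contradiction-irr u<w u≮w

joins-unique : ∀ {n} {G : Graph n} {e f : Edge G} {u w} → Joins e u w → Joins f u w → e ≡ f
joins-unique {G = G} j k =
  just-injective (trans (sym (joins-edgeBetween G j)) (joins-edgeBetween G k))

joins-distinct : ∀ {n} {G : Graph n} {e : Edge G} {u w} → Joins e u w → u ≢ w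
joins-distinct {e = edge u _ u<u _} forward  refl = contradiction-irr u<u (<-irrefl refl)
joins-distinct {e = edge u _ u<u _} backward refl = contradiction-irr u<u (<-irrefl refl)

_≟ᴱ_ : ∀ {n} {G : Graph n} → DecidableEquality (Edge G)
e@record{} ≟ᴱ f@record{} with lo e ≟ lo f | hi e ≟ hi f
... | yes refl | yes refl = yes refl
... | no lo≢   | _        = no (lo≢ ∘ cong lo)
... | _        | no hi≢   = no (hi≢ ∘ cong hi)

module _ {n} {G : Graph n} where

  -- Used with two properties: being labeled 0, and lying outside a given list of edges. In the
  -- second case the negation is `Separates`.
  Linked : (Edge G → Set) → Fin n → Fin n → Set
  Linked P u w = Σ[ p ∈ Walk G u w ] All P (walkEdges p)

  module _ {P : Edge G → Set} where

    linked-refl : ∀ {u} → Linked P u u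
    linked-refl = [] , []

    linked-joins : ∀ {e u w} → Joins e u w → P e → Linked P u w
    linked-joins j pe = step _ j [] , pe ∷ []

    linked-trans : ∀ {u w z} → Linked P u w → Linked P w z → Linked P u z
    linked-trans ([]         , [])      q = q
    linked-trans (step e j p , pe ∷ ps) q =
      let (r , rs) = linked-trans (p , ps) q in step e j r , pe ∷ rs

    linked-sym : ∀ {u w} → Linked P u w → Linked P w u
    linked-sym ([]         , [])      = linked-refl
    linked-sym (step e j p , pe ∷ ps) =
      linked-trans (linked-sym (p , ps)) (linked-joins (joins-sym j) pe)

    LinkedPath : Fin n → Fin n → Set
    LinkedPath u w = Σ[ p ∈ Path G u w ] All P (pathEdges p)

    suffix : ∀ {z u w} (p : Walk G u w) → Unique (walkNodes p) → All P (walkEdges p) →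
             z ∈ walkNodes p → LinkedPath z w
    suffix []           u       ps       (here refl) = record { walk = [] ; simple = u } , ps
    suffix (step e j p) u       ps       (here refl) =
      record { walk = step e j p ; simple = u } , ps
    suffix (step e j p) (_ ∷ u) (_ ∷ ps) (there z∈p) = suffix p u ps z∈p

    -- Loop erasure: if the first node recurs on the simplified remainder, the walk is cut short to
    -- the suffix starting there.
    simplify : ∀ {u w} → Linked P u w → LinkedPath u w
    simplify ([] , []) = record { walk = [] ; simple = [] ∷ [] } , []
    simplify {u} (step e j p , pe ∷ ps) with simplify (p , ps)
    ... | q , qs with _∈?_ _≟_ u (walkNodes (Path.walk q))
    ...   | yes u∈q = suffix (Path.walk q) (Path.simple q) qs u∈q
    ...   | no  u∉q =
      record { walk = step e j (Path.walk q) ; simple = ¬Any⇒All¬ _ u∉q ∷ Path.simple q } ,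
      pe ∷ qs

    nodes-length : ∀ {u w} (p : Walk G u w) → length (walkNodes p) ≡ suc (length (walkEdges p))
    nodes-length []           = refl
    nodes-length (step _ _ p) = cong suc (nodes-length p)

    record Represents (R : Matrix Bool n) : Set where
      field
        sound    : ∀ {u w} → T (R u w) → ∃[ e ] Joins e u w × P e
        complete : ∀ {e u w} → Joins e u w → P e → T (R u w)

    Sound : Matrix Bool n → Set
    Sound R = ∀ u w → T (R u w) → Linked P u w

    -- The first edge of the walk is not counted in m, as R need not be reflexive.
    Covers : ℕ → Matrix Bool n → Set
    Covers m R = ∀ {u z w e} → Joins e u z → P e → (p : Walk G z w) → All P (walkEdges p) →
                 length (walkEdges p) ≤ m → T (R u w)

    square-sound : ∀ R → Sound R → Sound (square R)
    square-sound R s u w t with square-elim R u w t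
    ... | inj₁ (z , uz , wz) = linked-trans (s u z uz) (linked-sym (s w z wz))
    ... | inj₂ uw            = s u w uw

    -- The walk is split after its first edge. Both pieces are covered by `R`, and symmetry turns
    -- the second one around to fit the product `R Rᵀ`.
    square-covers : ∀ {m} R → Symmetric R → Covers m R → Covers (suc m) (square R)
    square-covers R s c j pe []           ps        _       =
      square-extends R _ _ (c j pe [] ps z≤n)
    square-covers R s c j pe (step f k p) (pf ∷ ps) (s≤s l) =
      square-intro R _ _ _ (c j pe [] [] z≤n) (s _ _ (c k pf p ps l))

    iterate-sound : ∀ k R → Sound R → Sound (iterate square R k)
    iterate-sound zero    R s = s
    iterate-sound (suc k) R s = iterate-sound k (square R) (square-sound R s)

    iterate-covers : ∀ k {m} R → Symmetric R → Covers m R → Covers (k ℕ.+ m) (iterate square R k)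
    iterate-covers zero        R s c = c
    iterate-covers (suc k) {m} R s c
      rewrite sym (ℕ.+-suc k m) =
      iterate-covers k (square R) (square-symmetric R s) (square-covers R s c)

    module _ {R : Matrix Bool n} (represents : Represents R) where
      open Represents represents

      closure-sound : ∀ u w → T (closure R u w) → Linked P u w
      closure-sound = iterate-sound n R λ u w t →
        let (_ , j , pe) = sound t in linked-joins j pe

      -- The condition `u ≢ w` rules out the empty walk: `closure R` is not reflexive at a node
      -- without edges in `P`.
      closure-complete : ∀ {u w} → u ≢ w → Linked P u w → T (closure R u w)
      closure-complete {u} {w} u≢w l with simplify l
      ... | record { walk = [] } , _ = contradiction refl u≢w
      ... | record { walk = step e j p ; simple = _ ∷ unique } , pe ∷ ps =
        iterate-covers n R
          (λ u w t → let (_ , j , pe) = sound t in complete (joins-sym j) pe)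
          (λ where j pe [] _ _ → complete j pe
                   _ _ (step _ _ _) _ ()) j pe p ps
          -- The nodes of `p` are distinct, so `p` has fewer than `n` edges; the bound to be met is
          -- `n + 0`, as `R` itself covers single edges only.
          (ℕ.≤-trans (ℕ.n≤1+n _)
            (ℕ.≤-trans (ℕ.≤-reflexive (sym (nodes-length p)))
              (ℕ.≤-trans (unique-length unique) (ℕ.m≤m+n n 0))))

      closure-linked? : ∀ u w → Dec (Linked P u w)
      closure-linked? u w with u ≟ w
      ... | yes refl = yes linked-refl
      ... | no u≢w   = map′ (closure-sound u w) (closure-complete u≢w) (T? _)

  module _ {P : Edge G → Set} (P? : Decidable P) where

    edgeMatrix : Matrix Bool n
    edgeMatrix u w = maybe′ (λ e → ⌊ P? e ⌋) false (edgeBetween G u w)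

    edgeMatrix-represents : Represents edgeMatrix
    edgeMatrix-represents = record
      { sound    = λ {u} {w} → sound u w
      ; complete = λ j pe → complete j pe
      }
      where
      sound : ∀ u w → T (edgeMatrix u w) → ∃[ e ] Joins e u w × P e
      sound u w t with edgeBetween G u w in eq
      ... | just e = e , edgeBetween-joins G u w eq , toWitness t

      complete : ∀ {e u w} → Joins e u w → P e → T (edgeMatrix u w)
      complete j pe rewrite joins-edgeBetween G j = fromWitness pe

    linked? : ∀ u w → Dec (Linked P u w)
    linked? = closure-linked? edgeMatrix-represents

-- Consistency of partial labelings

sum-positive : {A : Set} (f : A → ℕ) (xs : List A) →
               1 ≤ sum (map f xs) ⊎ All (λ a → f a ≡ 0) xs
sum-positive f []       = inj₂ []
sum-positive f (x ∷ xs) with f x in eq | sum-positive f xs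
... | suc _ | _       = inj₁ (s≤s z≤n)
... | zero  | inj₁ p  = inj₁ p
... | zero  | inj₂ ps = inj₂ (eq ∷ ps)

-- The common pattern of the three families of inequalities: the left side is at most 1, so only a
-- vanishing right side is critical.
≤-sum : {A : Set} (f : A → ℕ) (xs : List A) {m : ℕ} →
        m ≤ 1 → (All (λ a → f a ≡ 0) xs → m ≡ 0) → m ≤ sum (map f xs)
≤-sum f xs m≤1 zeros⇒m≡0 with sum-positive f xs
... | inj₁ 1≤    = ℕ.≤-trans m≤1 1≤
... | inj₂ zeros = ℕ.≤-trans (ℕ.≤-reflexive (zeros⇒m≡0 zeros)) z≤n

just-value : {A : Set} {m : Maybe A} → Is-just m → ∃[ a ] m ≡ just a
just-value (Maybe.just {a} _) = a , refl

≢1⇒≡0 : {b : Fin 2} → b ≢ 1F → b ≡ 0F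
≢1⇒≡0 {0F} _  = refl
≢1⇒≡0 {1F} ≢1 = contradiction refl ≢1

sum-zero : {A : Set} {f : A → ℕ} {xs : List A} → All (λ a → f a ≡ 0) xs → sum (map f xs) ≡ 0
sum-zero []       = refl
sum-zero (p ∷ ps) = cong₂ _+_ p (sum-zero ps)

-- The label 0 stands for connected ends, hence the inversion.
truthLabel : {A : Set} → Dec A → Fin 2
truthLabel (yes _) = 0F
truthLabel (no  _) = 1F

truthLabel-yes : {A : Set} (a? : Dec A) → A → truthLabel a? ≡ 0F
truthLabel-yes (yes _) a = refl
truthLabel-yes (no ¬a) a = contradiction a ¬a

truthLabel-no : {A : Set} (a? : Dec A) → ¬ A → truthLabel a? ≡ 1F
truthLabel-no (yes a) ¬a = contradiction a ¬a
truthLabel-no (no _)  ¬a = refl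

truthLabel-zero : {A : Set} (a? : Dec A) → toℕ (truthLabel a?) ≡ 0 → A
truthLabel-zero (yes a) _ = a

-- Minimal cuts, and links along walks and cycles

module _ {n} {G : Graph n} where

  adjacent-joins : ∀ u w → T (adj G u w) → ∃[ e ] Joins {G = G} e u w
  adjacent-joins u w uw with <-cmp u w
  ... | tri< u<w _ _  = edge u w u<w uw , forward
  ... | tri≈ _ refl _ = contradiction (subst T (irreflexive G u) uw) λ ()
  ... | tri> _ _ w<u  = edge w u w<u (subst T (symmetric G u w) uw) , backward

  -- Every edge arises from both orders of its ends, hence the deduplication.
  edges : List (Edge G)
  edges = deduplicate _≟ᴱ_
    (mapMaybe (λ (u , w) → edgeBetween G u w) (cartesianProduct (allFin n) (allFin n)))

  edges-unique : Unique edges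
  edges-unique = deduplicate-! _≟ᴱ_ _

  ∈-edges : ∀ e → e ∈ edges
  ∈-edges e = ∈-deduplicate⁺ _≟ᴱ_
    (Any.mapMaybe⁺ _ _ (Any.map⁺
      (lose (∈-cartesianProduct⁺ (∈-allFin (lo e)) (∈-allFin (hi e)))
        (subst (Maybe.Any (e ≡_)) (sym (joins-edgeBetween G forward)) (Maybe.just refl)))))

  module _ {u w : Fin n} where

    separates-mono : ∀ {C D} → C ⊆ D → Separates G u w C → Separates G u w D
    separates-mono C⊆D s (p , ps) = s (p , All.map (λ e∉D e∈C → e∉D (C⊆D e∈C)) ps)

    separates? : ∀ D → Dec (Separates G u w D)
    separates? D = ¬? (linked? (λ e → ¬? (_∈?_ _≟ᴱ_ e D)) u w)

    delete : Edge G → List (Edge G) → List (Edge G)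
    delete e = filter (λ f → ¬? (e ≟ᴱ f))

    -- Redundant edges are deleted one at a time. When none is left, the set is minimal, because
    -- supersets of separating sets separate.
    cutWithin : ∀ D → Unique D → Separates G u w D → Σ[ C ∈ Cut G u w ] cutEdges C ⊆ D
    cutWithin D = go (suc (length D)) D ℕ.≤-refl
      where
      -- `k` is fuel for the recursion: each deletion shortens the list.
      go : ∀ k D → length D ℕ.< k → Unique D → Separates G u w D →
           Σ[ C ∈ Cut G u w ] cutEdges C ⊆ D
      go (suc k) D l unique s with Any.any? (λ e → separates? (delete e D)) D
      ... | yes redundant =
        let (e , e∈D , s′) = find redundant
            (C , C⊆) = go k (delete e D)
              (ℕ.≤-trans (filter-notAll _ D (lose e∈D (λ e≢e → e≢e refl))) (s≤s⁻¹ l))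
              (filter⁺ _ unique) s′
        in C , λ f∈C → proj₁ (∈-filter⁻ _ {xs = D} (C⊆ f∈C))
      ... | no irredundant = record
        { cutEdges  = D
        ; unique    = unique
        ; separates = s
        ; minimal   = minimal
        } , λ e∈D → e∈D
        where
        minimal : ∀ B → B ⊆ D → Separates G u w B → D ⊆ B
        minimal B B⊆D s {e} e∈D with _∈?_ _≟ᴱ_ e B
        ... | yes e∈B = e∈B
        ... | no  e∉B = contradiction (lose e∈D (separates-mono B⊆ s)) irredundant
          where
          B⊆ : B ⊆ delete e D
          B⊆ f∈B = ∈-filter⁺ _ (B⊆D f∈B) λ where refl → e∉B f∈B

  module _ {P : Edge G → Set} where

    EndsLinked : Edge G → Set
    EndsLinked e = Linked P (lo e) (hi e)

    -- The edge may belong to another graph `H`, as edges of `G′` are compared with walks in `G`.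
    linked-ends : ∀ {H : Graph n} {e : Edge H} {u w} →
                  Joins e u w → Linked P u w → Linked P (lo e) (hi e)
    linked-ends forward  l = l
    linked-ends backward l = linked-sym l

    ends-linked : ∀ {H : Graph n} {e : Edge H} {u w} →
                  Joins e u w → Linked P (lo e) (hi e) → Linked P u w
    ends-linked forward  l = l
    ends-linked backward l = linked-sym l

    walk-linked : ∀ {u w} (p : Walk G u w) → All EndsLinked (walkEdges p) → Linked P u w
    walk-linked []           []       = linked-refl
    walk-linked (step e j p) (l ∷ ls) = linked-trans (ends-linked j l) (walk-linked p ls)

    -- The given link joins the ends of the walk the other way round. Each edge before `e` is moved
    -- over to it; once `e` comes first, this link and the rest of the walk form a detour around
    -- `e`.
    walk-rest-linked : ∀ {u w} (p : Walk G u w) {e} (e∈p : e ∈ walkEdges p) →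
                       All EndsLinked (walkEdges p ─ e∈p) → Linked P u w → EndsLinked e
    walk-rest-linked (step f j p) (here refl) ls l =
      linked-ends j (linked-trans l (linked-sym (walk-linked p ls)))
    walk-rest-linked (step f j p) (there e∈p) (lf ∷ ls) l =
      walk-rest-linked p e∈p ls (linked-trans (linked-sym (ends-linked j lf)) l)

    cycle-rest-linked : ∀ (C : Cycle G) {e} (e∈C : e ∈ cycleEdges C) →
                        All EndsLinked (cycleEdges C ─ e∈C) → EndsLinked e
    cycle-rest-linked C (here refl) ls =
      linked-ends (joins-sym (Cycle.closes C)) (walk-linked (Path.walk (Cycle.path C)) ls)
    cycle-rest-linked C (there e∈p) (l ∷ ls) =
      walk-rest-linked (Path.walk (Cycle.path C)) e∈p ls
        (ends-linked (joins-sym (Cycle.closes C)) l)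

contradicts-zero : ∀ r {a b l} → l ≡ just 0F → ¬ T r → T (contradicts r (a , b , l))
contradicts-zero false refl _  = _
contradicts-zero true  refl ¬r = ¬r _

contradicts-one : ∀ r {a b l} → l ≡ just 1F → T r → T (contradicts r (a , b , l))
contradicts-one r refl t = t

contradicts-elim : ∀ r {a b l} → T (contradicts r (a , b , l)) →
                   (l ≡ just 0F × ¬ T r) ⊎ (l ≡ just 1F × T r)
contradicts-elim false {l = just 0F} _ = inj₁ (refl , λ ())
contradicts-elim r     {l = just 1F} t = inj₂ (refl , t)

reflects-not-any : ∀ {m} {A : Set} (M : Matrix Bool m) →
                   (¬ (∃[ u ] ∃[ w ] T (M u w)) → A) → (A → ¬ (∃[ u ] ∃[ w ] T (M u w))) →
                   Reflects A (not (any λ u → any (M u)))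
reflects-not-any M none⇒a a⇒none with any (λ u → any (M u)) in eq
... | false = ofʸ (none⇒a λ (u , w , t) →
  subst T eq (any-T (λ u → any (M u)) u (any-T (M u) w t)))
... | true  = ofⁿ λ a →
  let (u , t′) = T-any (λ u → any (M u)) (subst T (sym eq) _)
      (w , t)  = T-any (M u) t′
  in a⇒none a (u , w , t)

-- Coherence as a criterion for consistency, and correctness of the program

module _ (I : Instance) where
  open Instance I

  ZeroEdge : Edge G → Set
  ZeroEdge e = x̃ (include G⊆G′ e) ≡ just 0F

  zeroEdge? : ∀ e → Dec (ZeroEdge e)
  zeroEdge? e = ≡-dec _≟_ (x̃ (include G⊆G′ e)) (just 0F)

  ZeroLinked : Edge G′ → Set
  ZeroLinked f = Linked ZeroEdge (lo f) (hi f)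

  Coherent : Set
  Coherent = ∀ f → (x̃ f ≡ just 0F → ZeroLinked f) × (x̃ f ≡ just 1F → ¬ ZeroLinked f)

  module _ (coherent : Coherent) where

    zeroLinked? : ∀ f → Dec (ZeroLinked f)
    zeroLinked? f = linked? zeroEdge? (lo f) (hi f)

    x : Edge G′ → Fin 2
    x f = truthLabel (zeroLinked? f)

    linked⇒zero : ∀ f → ZeroLinked f → x f ≡ 0F
    linked⇒zero f = truthLabel-yes (zeroLinked? f)

    unlinked⇒one : ∀ f → ¬ ZeroLinked f → x f ≡ 1F
    unlinked⇒one f = truthLabel-no (zeroLinked? f)

    zero⇒linked : ∀ f → toℕ (x f) ≡ 0 → ZeroLinked f
    zero⇒linked f = truthLabel-zero (zeroLinked? f)

    x≤1 : ∀ f → toℕ (x f) ≤ 1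
    x≤1 f = s≤s⁻¹ (toℕ<n (x f))

    x∈X : X G G′ G⊆G′ x
    x∈X = record { cycles = cycles ; paths = paths ; cuts = cuts }
      where
      value : Edge G → ℕ
      value e = toℕ (x (include G⊆G′ e))

      linked : ∀ e → value e ≡ 0 → Linked ZeroEdge (lo e) (hi e)
      linked e = zero⇒linked (include G⊆G′ e)

      cycles : ∀ (C : Cycle G) {e} (e∈C : e ∈ cycleEdges C) →
               value e ≤ sum (map value (cycleEdges C ─ e∈C))
      cycles C {e} e∈C = ≤-sum value (cycleEdges C ─ e∈C) (x≤1 (include G⊆G′ e)) λ zeros →
        cong toℕ (linked⇒zero (include G⊆G′ e)
          (cycle-rest-linked C e∈C (All.map (λ {e} → linked e) zeros)))

      paths : ∀ f → Lifted G f → (P : Path G (lo f) (hi f)) →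
              toℕ (x f) ≤ sum (map value (pathEdges P))
      paths f _ P = ≤-sum value (pathEdges P) (x≤1 f) λ zeros →
        cong toℕ (linked⇒zero f (walk-linked (Path.walk P) (All.map (λ {e} → linked e) zeros)))

      cuts : ∀ f → Lifted G f → (C : Cut G (lo f) (hi f)) →
             1 ∸ toℕ (x f) ≤ sum (map (λ e → 1 ∸ value e) (cutEdges C))
      -- If the right side vanishes, `x` is 1 on all of `C`, so a walk of 0-edges between the ends
      -- of `f` would avoid `C`.
      cuts f _ C = ≤-sum (λ e → 1 ∸ value e) (cutEdges C) (ℕ.m∸n≤m 1 (toℕ (x f))) λ ones →
        cong (λ b → 1 ∸ toℕ b) (unlinked⇒one f λ (p , ps) →
          Cut.separates C (p , All.map (zero∉C ones) ps))
        where
        zero∉C : All (λ e → 1 ∸ value e ≡ 0) (cutEdges C) → ∀ {e} → ZeroEdge e → e ∉ cutEdges C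
        zero∉C ones {e} ze e∈C = contradiction
          (trans (sym (cong (λ b → 1 ∸ toℕ b)
                   (linked⇒zero (include G⊆G′ e) (linked-joins {e = e} forward ze))))
                 (All.lookup ones e∈C))
          λ ()

    x-extends : ∀ f b → x̃ f ≡ just b → x f ≡ b
    x-extends f 0F eq = linked⇒zero f (proj₁ (coherent f) eq)
    x-extends f 1F eq = unlinked⇒one f (proj₂ (coherent f) eq)

    coherent⇒consistent : Consistent I
    coherent⇒consistent = x , x∈X , x-extends

  lower : ∀ (f : Edge G′) → T (adj G (lo f) (hi f)) →
          Σ[ e ∈ Edge G ] include G⊆G′ e ≡ f × Joins e (lo f) (hi f)
  lower (edge u w u<w _) uw = edge u w u<w uw , refl , forward

  module _ {x : Edge G′ → Fin 2} (x∈X : X G G′ G⊆G′ x)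
           (extends : ∀ f b → x̃ f ≡ just b → x f ≡ b) where
    open X x∈X

    one≰zeros : ∀ {f es} → x̃ f ≡ just 1F → All ZeroEdge es →
                ¬ toℕ (x f) ≤ sum (map value es)
    one≰zeros {f} f≡1 zeros x≤sum = contradiction
      (subst₂ _≤_ (cong toℕ (extends f 1F f≡1))
                  (sum-zero (All.map (cong toℕ ∘ extends _ 0F) zeros)) x≤sum)
      λ ()

    -- An empty walk would make `e` a loop, and the edge of a walk of length one would be `e`
    -- itself, labeled 0 and 1. Any longer path is closed by `e` to a cycle that violates its
    -- inequality.
    closed-by-one : ∀ {e u w} → x̃ (include G⊆G′ e) ≡ just 1F → Joins e u w →
                    (p : Walk G u w) → Unique (walkNodes p) → ¬ All ZeroEdge (walkEdges p)
    closed-by-one e≡1 j []             _      _          = joins-distinct j refl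
    closed-by-one e≡1 j (step _ j′ []) _      (≡0 ∷ []) =
      contradiction (trans (sym (subst ZeroEdge (joins-unique j′ j) ≡0)) e≡1) λ ()
    closed-by-one {e} e≡1 j p@(step _ _ (step _ _ _)) unique zeros =
      one≰zeros e≡1 zeros (cycles (record
        { path    = record { walk = p ; simple = unique }
        ; long    = s≤s (s≤s z≤n)
        ; closing = e
        ; closes  = joins-sym j
        }) (here refl))

    oneLabel⇒unlinked : ∀ f → x̃ f ≡ just 1F → ¬ ZeroLinked f
    oneLabel⇒unlinked f f≡1 l = go f f≡1 (T? (adj G (lo f) (hi f))) (simplify l)
      where
      go : ∀ f → x̃ f ≡ just 1F → Dec (T (adj G (lo f) (hi f))) →
           ¬ LinkedPath {P = ZeroEdge} (lo f) (hi f)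
      go f f≡1 (no  f∉G) (P , zeros) = one≰zeros f≡1 zeros (paths f f∉G P)
      go f f≡1 (yes f∈G) (P , zeros) =
        let (e , e≡f , j) = lower f f∈G
        in closed-by-one (trans (cong x̃ e≡f) f≡1) j (Path.walk P) (Path.simple P) zeros

    -- Under the first promise `e` has a label, and `x` must agree with it.
    determined : E⊆dom I → ∀ e → x (include G⊆G′ e) ≡ 0F → ZeroEdge e
    determined E⊆ e e≡0 =
      let (b , eq) = just-value (E⊆ e)
      in trans eq (cong just (trans (sym (extends (include G⊆G′ e) b eq)) e≡0))

    -- If f were not linked, then the edges labeled 1 would separate its ends
    -- and thus contain a cut, in violation of the cut inequality.
    dom⇒linked : E⊆dom I → ∀ f → Lifted G f → x̃ f ≡ just 0F → ZeroLinked f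
    dom⇒linked E⊆ f f∉G f≡0 = decidable-stable (linked? zeroEdge? (lo f) (hi f)) λ ¬l →
      let (C , C⊆ones) = cutWithin ones (filter⁺ one? edges-unique) (ones-separate ¬l)
      in 1≰0 (subst₂ _≤_
           (cong (λ b → 1 ∸ toℕ b) (extends f 0F f≡0))
           (sum-zero {f = λ e → 1 ∸ value e}
             (All.tabulate λ e∈C → cong (λ b → 1 ∸ toℕ b) (one (C⊆ones e∈C))))
           (cuts f f∉G C))
      where
      1≰0 : ¬ 1 ≤ 0
      1≰0 ()

      One : Edge G → Set
      One e = x (include G⊆G′ e) ≡ 1F

      one? : ∀ e → Dec (One e)
      one? e = x (include G⊆G′ e) ≟ 1F

      ones : List (Edge G)
      ones = filter one? edges

      one : ∀ {e} → e ∈ ones → One e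
      one e∈ones = proj₂ (∈-filter⁻ one? {xs = edges} e∈ones)

      zero-outside : ∀ {e} → e ∉ ones → ZeroEdge e
      zero-outside {e} e∉ones =
        determined E⊆ e (≢1⇒≡0 λ e≡1 → e∉ones (∈-filter⁺ one? (∈-edges e) e≡1))

      ones-separate : ¬ ZeroLinked f → Separates G (lo f) (hi f) ones
      ones-separate ¬l (p , ps) = ¬l (p , All.map zero-outside ps)

    lifted⇒linked : E⊆dom I ⊎ LiftedZerosHaveZeroPaths I →
                    ∀ f → Lifted G f → x̃ f ≡ just 0F → ZeroLinked f
    lifted⇒linked (inj₁ E⊆)       f f∉G f≡0 = dom⇒linked E⊆ f f∉G f≡0
    lifted⇒linked (inj₂ hasPaths) f f∉G f≡0 =
      [ (λ f≡1 → contradiction (trans (sym f≡0) f≡1) λ ())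
      , (λ (P , zeros) → Path.walk P , zeros)
      ]′ (hasPaths f (subst Is-just (sym f≡0) (Maybe.just _)) f∉G)

    zeroLabel⇒linked : E⊆dom I ⊎ LiftedZerosHaveZeroPaths I →
                       ∀ f → x̃ f ≡ just 0F → ZeroLinked f
    zeroLabel⇒linked promise f f≡0 = go (T? (adj G (lo f) (hi f)))
      where
      go : Dec (T (adj G (lo f) (hi f))) → ZeroLinked f
      go (no  f∉G) = lifted⇒linked promise f f∉G f≡0
      go (yes f∈G) =
        let (e , e≡f , j) = lower f f∈G in linked-joins j (trans (cong x̃ e≡f) f≡0)

  consistent⇒coherent : E⊆dom I ⊎ LiftedZerosHaveZeroPaths I → Consistent I → Coherent
  consistent⇒coherent promise (x , x∈X , extends) f =
    zeroLabel⇒linked x∈X extends promise f , oneLabel⇒unlinked x∈X extends f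

  entry : Matrix Entry n
  entry = instanceMatrix I

  zeros-represent : Represents {G = G} {P = ZeroEdge} (zeros entry)
  zeros-represent = record { sound = λ {u} {w} → sound u w ; complete = complete }
    where
    isZero-just : ∀ {m} → T (isZero m) → m ≡ just 0F
    isZero-just {just 0F} _ = refl

    edgeBetween-include : ∀ {e u w} → Joins e u w →
                          edgeBetween G′ u w ≡ just (include G⊆G′ e)
    edgeBetween-include {edge _ _ _ _} forward  = joins-edgeBetween G′ forward
    edgeBetween-include {edge _ _ _ _} backward = joins-edgeBetween G′ backward

    present : ∀ {e u w} → Joins {G = G} e u w → T (adj G u w)
    -- The stored proof is irrelevant and is recovered by decidability.
    present {edge u w _ uw} forward  = recompute (T? _) uw
    present {edge u w _ uw} backward = subst T (symmetric G u w) (recompute (T? _) uw)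

    sound : ∀ u w → T (zeros entry u w) → ∃[ e ] Joins e u w × ZeroEdge e
    sound u w t =
      let (uw , z) = Equivalence.to (T-∧ {adj G u w}) t
          (e , j)  = adjacent-joins u w uw
      in e , j , trans (sym (cong (_>>= x̃) (edgeBetween-include j))) (isZero-just z)

    complete : ∀ {e u w} → Joins e u w → ZeroEdge e → T (zeros entry u w)
    complete {e} {u} {w} j z =
      Equivalence.from (T-∧ {adj G u w}) (present j ,
        subst (T ∘ isZero)
          (sym (trans (cong (_>>= x̃) (edgeBetween-include j)) z)) _)

  label-edge : ∀ u w {b} → (edgeBetween G′ u w >>= x̃) ≡ just b →
               ∃[ f ] Joins f u w × x̃ f ≡ just b
  label-edge u w f≡b with edgeBetween G′ u w in eq
  ... | just f = f , edgeBetween-joins G′ u w eq , f≡b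

  edge-label : ∀ f → (edgeBetween G′ (lo f) (hi f) >>= x̃) ≡ x̃ f
  edge-label f = cong (_>>= x̃) (joins-edgeBetween G′ {f} forward)

  contradictory : Matrix Bool n
  contradictory u w = contradicts (closure (zeros entry) u w) (entry u w)

  none⇒coherent : ¬ (∃[ u ] ∃[ w ] T (contradictory u w)) → Coherent
  none⇒coherent none f = zero-case , one-case
    where
    u = lo f
    w = hi f
    reached = closure (zeros entry) u w

    zero-case : x̃ f ≡ just 0F → ZeroLinked f
    zero-case f≡0 = closure-sound zeros-represent u w
      (decidable-stable (T? reached) λ ¬r →
        none (u , w , contradicts-zero reached (trans (edge-label f) f≡0) ¬r))

    one-case : x̃ f ≡ just 1F → ¬ ZeroLinked f
    one-case f≡1 l = none (u , w , contradicts-one reached (trans (edge-label f) f≡1)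
      (closure-complete zeros-represent (joins-distinct {e = f} forward) l))

  -- Only labeled entries can be contradictory. They come from edges of `G′`, so `u` and `w` differ,
  -- as `closure-complete` requires.
  coherent⇒none : Coherent → ¬ (∃[ u ] ∃[ w ] T (contradictory u w))
  coherent⇒none coherent (u , w , t) =
    [ zero-case , one-case ]′ (contradicts-elim (closure (zeros entry) u w) t)
    where
    uw-label : Maybe (Fin 2)
    uw-label = edgeBetween G′ u w >>= x̃

    reached = closure (zeros entry) u w

    zero-case : uw-label ≡ just 0F × ¬ T reached → ⊥
    zero-case (≡0 , ¬r) =
      let (f , j , f≡0) = label-edge u w ≡0
      in ¬r (closure-complete zeros-represent (joins-distinct j)
               (ends-linked j (proj₁ (coherent f) f≡0)))

    one-case : uw-label ≡ just 1F × T reached → ⊥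
    one-case (≡1 , r) =
      let (f , j , f≡1) = label-edge u w ≡1
      in proj₂ (coherent f) f≡1 (linked-ends j (closure-sound zeros-represent u w r))

  accepts-reflects : E⊆dom I ⊎ LiftedZerosHaveZeroPaths I → Reflects (Consistent I) (accepts entry)
  accepts-reflects promise = reflects-not-any contradictory
    (coherent⇒consistent ∘ none⇒coherent)
    (coherent⇒none ∘ consistent⇒coherent promise)

lemma6 : DecidableInPolynomialTime encode (λ I → E⊆dom I ⊎ LiftedZerosHaveZeroPaths I) Consistent
lemma6 =
  let (c , k , runs) = program-runs
  in program , c , k , λ I promise →
     let (t , run , t≤) = runs I
     in accepts (instanceMatrix I) , t , run , t≤ , accepts-reflects I promise
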